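{- For every integer $n\ge 1$, $$\mathrm{pf}_n(132,231)=\sum_{k=0}^{n-1}\binom{n-1}{k}C_{n-k},$$ where $C_j=\frac{1}{j+1}\binom{2j}{j}$ is the $j$th Catalan number.
   Context: A Dyck path of semilength $n$ is a lattice path from $(0,0)$ to $(n,n)$ consisting of $n$ north steps $N=(0,1)$ and $n$ east steps $E=(1,0)$ that never goes below the line $y=x$. A parking function of size $n$ is a Dyck path of semilength $n$ whose $n$ north steps are labeled bijectively by $\{1,\dots,n\}$ so that whenever two north steps are consecutive in the path (one immediately following the other), the label of the later one is larger. For a parking function $p$ of size $n$, $\phi(p)$ is the permutation of $\{1,\dots,n\}$ (in one-line notation) obtained by reading the labels of the north steps in the order they occur along the path. A permutation $\pi$ of $\{1,\dots,n\}$ contains a permutation $\rho$ of $\{1,\dots,m\}$ if there are indices $1\le i_1<\cdots<i_m\le n$ such that $\pi_{i_a}\le\pi_{i_b}$ if and only if $\rho_a\le\rho_b$; otherwise $\pi$ avoids $\rho$. For permutations $\rho_1,\dots,\rho_r$, $\mathrm{pf}_n(\rho_1,\dots,\rho_r)$ denotes the number of parking functions $p$ of size $n$ such that $\phi(p)$ avoids each of $\rho_1,\dots,\rho_r$. -}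

module Defs where

open import Data.Fin using (Fin)
import Data.Fin as Fin
open import Data.List using (List; []; _∷_; length; lookup; map; take; applyUpTo)
open import Data.List.Relation.Binary.Permutation.Propositional using (_↭_; ↭-refl; prep; swap; trans)
open import Data.List.Relation.Unary.All using (All)
open import Data.List.Relation.Unary.Linked using (Linked)
open import Data.Nat using (ℕ; suc; _*_; _/_; _≤_; _<_)
open import Data.Nat.Combinatorics using (_C_)
open import Data.Product using (Σ; ∃; _×_; _,_; proj₁)
open import Data.Unit using (⊤)
open import Function using (_∘_)
open import Function.Bundles using (_⇔_; Inverse)
open import Level using (0ℓ)
open import Relation.Binary.Bundles using (Setoid)
import Relation.Binary.Construct.On as On
open import Relation.Binary.PropositionalEquality using (_≡_; setoid)
open import Relation.Nullary using (¬_)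

data Step : Set where
  N E : Step

norths : List Step → ℕ
norths []      = 0
norths (N ∷ p) = suc (norths p)
norths (E ∷ p) = norths p

easts : List Step → ℕ
easts []      = 0
easts (N ∷ p) = easts p
easts (E ∷ p) = suc (easts p)

-- After its first k steps a path is at (easts (take k p) , norths (take k p)).
record IsDyckPath (n : ℕ) (p : List Step) : Set where
  field
    norths≡n      : norths p ≡ n
    easts≡n       : easts p ≡ n
    neverBelowY=X : ∀ k → easts (take k p) ≤ norths (take k p)

-- A permutation of {1,…,n}, as a word in one-line notation.
record Perm (n : ℕ) : Set where
  constructor perm
  field
    oneLine       : List ℕ
    isPermutation : oneLine ↭ applyUpTo suc n

open Perm public

Contains : ∀ {n m} → Perm n → Perm m → Set
Contains π ρ =
  Σ (Fin (length (oneLine ρ)) → Fin (length (oneLine π))) λ i →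
    (∀ a b → a Fin.< b → i a Fin.< i b) ×
    (∀ a b → (lookup (oneLine π) (i a) ≤ lookup (oneLine π) (i b))
           ⇔ (lookup (oneLine ρ) a ≤ lookup (oneLine ρ) b))

Avoids : ∀ {n m} → Perm n → Perm m → Set
Avoids π ρ = ¬ Contains π ρ

data LabelledStep : Set where
  N : ℕ → LabelledStep
  E : LabelledStep

forgetLabel : LabelledStep → Step
forgetLabel (N _) = N
forgetLabel E     = E

labels : List LabelledStep → List ℕ
labels []        = []
labels (N l ∷ w) = l ∷ labels w
labels (E ∷ w)   = labels w

RisingIfNorths : LabelledStep → LabelledStep → Set
RisingIfNorths (N a) (N b) = a < b
RisingIfNorths (N _) E     = ⊤
RisingIfNorths E     _     = ⊤

record ParkingFunction (n : ℕ) : Set where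
  field
    steps     : List LabelledStep
    isDyck    : IsDyckPath n (map forgetLabel steps)
    bijective : labels steps ↭ applyUpTo suc n
    rising    : Linked RisingIfNorths steps

open ParkingFunction public

φ : ∀ {n} → ParkingFunction n → Perm n
φ p = perm (labels (steps p)) (bijective p)

AvoidingParkingFunction : ℕ → List (∃ Perm) → Set
AvoidingParkingFunction n ρs =
  Σ (ParkingFunction n) λ p → All (λ (_ , ρ) → Avoids (φ p) ρ) ρs

-- Two parking functions are equal when their labelled paths are; the proofs
-- of the side conditions are ignored, so that each one is counted once.
avoidingParkingFunctions : ℕ → List (∃ Perm) → Setoid 0ℓ 0ℓ
avoidingParkingFunctions n ρs = record
  { Carrier       = AvoidingParkingFunction n ρs
  ; _≈_           = λ p q → steps (proj₁ p) ≡ steps (proj₁ q)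
  ; isEquivalence = On.isEquivalence (steps ∘ proj₁)
                      (Setoid.isEquivalence (setoid (List LabelledStep)))
  }

HasCardinality : Setoid 0ℓ 0ℓ → ℕ → Set
HasCardinality S k = Inverse S (setoid (Fin k))

p132 : Perm 3
p132 = perm (1 ∷ 3 ∷ 2 ∷ []) (prep 1 (swap 3 2 ↭-refl))

p231 : Perm 3
p231 = perm (2 ∷ 3 ∷ 1 ∷ []) (trans (prep 2 (swap 3 1 ↭-refl)) (swap 2 1 ↭-refl))

-- The division is exact.
catalan : ℕ → ℕ
catalan j = ((2 * j) C j) / suc j

{-# OPTIONS --safe #-}
-- A permutation avoids 132 and 231 exactly when it has no peak, that is, when it decreases
-- to 1 and increases afterwards; it is determined by the set of the k labels before 1.
-- Each descent forces an east step between the two north steps, and from the diagonal N E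
-- leads back to the diagonal, so the path is (N E)^k followed by an arbitrary Dyck path of
-- semilength n − k. Inserting the labels from the largest to the smallest, each at
-- the left or at the right end, turns this count into the Pascal recursion of `valleys`.
module Submission where

open import Data.Empty using (⊥; ⊥-elim)
open import Data.Fin using (Fin; zero; suc)
import Data.Fin as Fin
open import Data.Fin.Properties using (+↔⊎; 1↔⊤)
open import Data.List using (List; []; _∷_; [_]; _++_; applyUpTo; length; lookup; map; sum; take; upTo)
open import Data.List.Membership.Propositional.Properties using (∈-∃++; ∈-applyUpTo⁺)
open import Data.List.Properties using (++-assoc; ++-identityʳ; applyUpTo-∷ʳ; length-applyUpTo; map-upTo; ∷-injectiveʳ; ∷-injective)
open import Data.List.Relation.Binary.Permutation.Propositional using (_↭_; ↭-prep; ↭-reflexive; ↭-sym; ↭-trans; ↭⇒↭ₛ)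
open import Data.List.Relation.Binary.Permutation.Propositional.Properties using (All-resp-↭; ↭-length; ↭-singleton-inv; drop-mid; shift; ∈-resp-↭)
import Data.List.Relation.Binary.Permutation.Setoid.Properties as Permutationₛ
open import Data.List.Relation.Binary.Sublist.Propositional using (_⊆_; []; _∷_; _∷ʳ_; minimum; ⊆-refl; ⊆-trans)
open import Data.List.Relation.Binary.Sublist.Propositional.Properties using (All-resp-⊆)
import Data.List.Relation.Binary.Sublist.Propositional.Properties as Sublist
open import Data.List.Relation.Unary.All using (All; []; _∷_)
open import Data.List.Relation.Unary.All.Properties using () renaming (applyUpTo⁺₁ to All-applyUpTo⁺; ++⁻ to All-++⁻)
open import Data.List.Relation.Unary.AllPairs using (AllPairs; []; _∷_)
open import Data.List.Relation.Unary.Linked as Linked using (Linked; []; [-]; _∷_)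
open import Data.List.Relation.Unary.Linked.Properties using (Linked⇒AllPairs)
open import Data.List.Relation.Unary.Unique.Propositional using (Unique)
open import Data.List.Relation.Unary.Unique.Propositional.Properties using (applyUpTo⁺₁)
open import Data.Nat using (ℕ; zero; suc; _+_; _*_; _∸_; _/_; _≤_; _<_; _≥_; z≤n; s≤s; s≤s⁻¹; z<s; s<s)
open import Data.Nat.Combinatorics using (_C_; nCk≡nC[n∸k]; nCk+nC[k+1]≡[n+1]C[k+1])
open import Data.Nat.Combinatorics.Specification using (k>n⇒nCk≡0)
open import Data.Nat.DivMod using (m*n/n≡m)
open import Data.Nat.ListAction using () renaming (sum to ∑)
open import Data.Nat.Properties
open import Data.Nat.Solver using (module +-*-Solver)
open import Data.Product using (∃; ∃₂; _×_; _,_; proj₁; proj₂)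
open import Data.Sum using (inj₁; inj₂)
open import Data.Sum.Function.Propositional using (_⊎-↔_)
open import Data.Unit using (tt)
open import Function using (_∘_)
open import Function.Bundles using (Inverse; _↔_; _⇔_; mk⇔; mk↔ₛ′; Equivalence)
import Function.Construct.Composition as Composition
import Function.Construct.Symmetry as Symmetry
open import Function.Properties.Bijection using (Bijection⇒Inverse)
open import Function.Properties.Inverse using (↔-sym; ↔-trans)
open import Level using (0ℓ)
open import Relation.Binary.Bundles using (Setoid)
open import Relation.Binary.Definitions using (tri<; tri≈; tri>)
open import Relation.Binary.PropositionalEquality using (_≡_; _≢_; refl; sym; trans; cong; cong₂; subst; setoid; module ≡-Reasoning)
open import Relation.Nullary using (¬_; contradiction)
open import Defs

open +-*-Solver using (solve; _:=_; _:+_; _:*_; con)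

private
  variable
    h j l : ℕ
    ls acc : List ℕ

-- Ballot numbers, the reflection principle and Catalan numbers

-- Counts the ways to finish a path that stands `h` above the diagonal and has `r` north steps left;
-- the recursion splits on the next step.
ballots : ℕ → ℕ → ℕ
ballots zero    zero    = 1
ballots zero    (suc r) = ballots 1 r
ballots (suc h) zero    = ballots h zero
ballots (suc h) (suc r) = ballots (suc (suc h)) r + ballots h (suc r)

-- The binomial coefficient `n C (r - 1)`, with value 0 at `r = 0`, where truncated subtraction
-- would give 1.
_C⁻_ : ℕ → ℕ → ℕ
n C⁻ zero  = 0
n C⁻ suc r = n C r

pascal : ∀ n k → suc n C suc k ≡ n C k + n C suc k
pascal n k = sym (nCk+nC[k+1]≡[n+1]C[k+1] n k)

pascal⁻ : ∀ n r → suc n C r ≡ n C⁻ r + n C r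
pascal⁻ n zero    = refl
pascal⁻ n (suc r) = pascal n r

-- The reflection principle: of the N C r paths with r north steps left, those that cross
-- the diagonal correspond to the N C (r − 1) paths with one north step fewer.
ballots-reflection : ∀ h r N → N ≡ h + (r + r) → ballots h r + N C⁻ r ≡ N C r
ballots-reflection zero    zero    _ _    = refl
ballots-reflection (suc h) zero    _ _    = ballots-reflection h zero h (sym (+-identityʳ h))
ballots-reflection zero    (suc r) _ refl = begin
  ballots 1 r + suc M C r            ≡⟨ cong (ballots 1 r +_) (pascal⁻ M r) ⟩
  ballots 1 r + (M C⁻ r + M C r)     ≡⟨ +-assoc (ballots 1 r) _ _ ⟨
  ballots 1 r + M C⁻ r + M C r       ≡⟨ cong (_+ M C r) (ballots-reflection 1 r M (+-suc r r)) ⟩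
  M C r + M C r                      ≡⟨ cong (M C r +_) symmetric ⟩
  M C r + M C suc r                  ≡⟨ pascal M r ⟨
  suc M C suc r                      ∎
  where
  open ≡-Reasoning
  M = r + suc r
  -- `M` is `2 r + 1`, an odd number, so its two middle binomial coefficients agree. This makes up
  -- for the east step that is forbidden on the diagonal.
  symmetric : M C r ≡ M C suc r
  symmetric = trans (nCk≡nC[n∸k] (m≤m+n r (suc r))) (cong (M C_) (m+n∸m≡n r (suc r)))
ballots-reflection (suc h) (suc r) _ refl = begin
  a + b + suc M C r                  ≡⟨ cong (a + b +_) (pascal⁻ M r) ⟩
  a + b + (M C⁻ r + M C r)           ≡⟨ solve 4 (λ a b c d → a :+ b :+ (c :+ d) := (a :+ c) :+ (b :+ d)) refl a b (M C⁻ r) (M C r) ⟩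
  (a + M C⁻ r) + (b + M C r)         ≡⟨ cong₂ _+_ (ballots-reflection (2 + h) r M shiftʰ) (ballots-reflection h (suc r) M refl) ⟩
  M C r + M C suc r                  ≡⟨ pascal M r ⟨
  suc M C suc r                      ∎
  where
  open ≡-Reasoning
  M = h + (suc r + suc r)
  a = ballots (2 + h) r
  b = ballots h (suc r)
  shiftʰ : M ≡ 2 + h + (r + r)
  shiftʰ = solve 2 (λ h r → h :+ ((con 1 :+ r) :+ (con 1 :+ r)) := con 2 :+ h :+ (r :+ r)) refl h r

-- (k + 1) (n choose k + 1) = (n − k) (n choose k), stated without truncated subtraction.
absorption : ∀ n k → suc k * (n C suc k) + k * (n C k) ≡ n * (n C k)
absorption zero    zero    = refl
absorption zero    (suc k) = cong₂ _+_ (*-zeroʳ (2 + k)) (*-zeroʳ (1 + k))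
absorption (suc n) zero    = begin
  1 * (suc n C 1) + 0                ≡⟨ cong (λ x → 1 * x + 0) (pascal n 0) ⟩
  1 * (1 + n C 1) + 0                ≡⟨ solve 1 (λ x → con 1 :* (con 1 :+ x) :+ con 0 := con 1 :+ (con 1 :* x :+ con 0)) refl (n C 1) ⟩
  1 + (1 * (n C 1) + 0)              ≡⟨ cong suc (absorption n 0) ⟩
  suc n * 1                          ∎
  where open ≡-Reasoning
absorption (suc n) (suc k) = begin
  (2 + k) * (suc n C (2 + k)) + suc k * (suc n C suc k)
    ≡⟨ cong₂ (λ x y → (2 + k) * x + suc k * y) (pascal n (suc k)) (pascal n k) ⟩
  (2 + k) * (b + c) + suc k * (a + b)
    ≡⟨ solve 4 (λ k a b c → (con 2 :+ k) :* (b :+ c) :+ (con 1 :+ k) :* (a :+ b)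
                  := ((con 2 :+ k) :* c :+ (con 1 :+ k) :* b) :+ ((con 1 :+ k) :* b :+ k :* a) :+ (a :+ b))
         refl k a b c ⟩
  ((2 + k) * c + suc k * b) + (suc k * b + k * a) + (a + b)
    ≡⟨ cong₂ (λ x y → x + y + (a + b)) (absorption n (suc k)) (absorption n k) ⟩
  n * b + n * a + (a + b)
    ≡⟨ solve 3 (λ n a b → n :* b :+ n :* a :+ (a :+ b) := (con 1 :+ n) :* (a :+ b)) refl n a b ⟩
  suc n * (a + b)
    ≡⟨ cong (suc n *_) (pascal n k) ⟨
  suc n * (suc n C suc k) ∎
  where
  open ≡-Reasoning
  a = n C k
  b = n C suc k
  c = n C (2 + k)

-- With `i = suc m`, reflection gives `ballots 0 i + a ≡ b` and absorption gives
-- `i * b ≡ suc i * a`. Eliminating `a` leaves `ballots 0 i * suc i ≡ b`, so the division is exact.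
ballots-catalan : ∀ m → ballots 0 (suc m) ≡ catalan (suc m)
ballots-catalan m = begin
  ballots 0 i                        ≡⟨ m*n/n≡m (ballots 0 i) (suc i) ⟨
  (ballots 0 i * suc i) / suc i      ≡⟨ cong (_/ suc i) multiplied ⟩
  ((2 * i) C i) / suc i              ∎
  where
  open ≡-Reasoning
  i = suc m
  a = (2 * i) C m
  b = (2 * i) C i
  absorbed : i * b ≡ suc i * a
  absorbed = +-cancelʳ-≡ (m * a) (i * b) (suc i * a) (begin
    i * b + m * a                    ≡⟨ absorption (2 * i) m ⟩
    2 * i * a                        ≡⟨ solve 2 (λ m a → con 2 :* (con 1 :+ m) :* a := (con 2 :+ m) :* a :+ m :* a) refl m a ⟩
    suc i * a + m * a                ∎)
  multiplied : ballots 0 i * suc i ≡ b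
  multiplied = +-cancelʳ-≡ (suc i * a) _ _ (begin
    ballots 0 i * suc i + suc i * a  ≡⟨ solve 3 (λ x s a → x :* s :+ s :* a := s :* (x :+ a)) refl (ballots 0 i) (suc i) a ⟩
    suc i * (ballots 0 i + a)        ≡⟨ cong (suc i *_) (ballots-reflection 0 i (2 * i) (cong (i +_) (+-identityʳ i))) ⟩
    b + i * b                        ≡⟨ cong (b +_) absorbed ⟩
    b + suc i * a                    ∎)

-- The Pascal recursion and the binomial sum

-- Here `m` is the number of labels already placed on the right. Label `suc j` goes to the left and
-- keeps `m`, or to the right and raises it; at the end label 1 and the `m` others label a Dyck
-- path.
valleys : ℕ → ℕ → ℕ
valleys zero    m = ballots 0 (suc m)
valleys (suc j) m = valleys j m + valleys j (suc m)

sum-applyUpTo-∷ʳ : ∀ f n → ∑ (applyUpTo f (suc n)) ≡ ∑ (applyUpTo f n) + f n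
sum-applyUpTo-∷ʳ f zero    = +-identityʳ (f 0)
sum-applyUpTo-∷ʳ f (suc n) = trans (cong (f 0 +_) (sum-applyUpTo-∷ʳ (f ∘ suc) n)) (sym (+-assoc (f 0) _ _))

sum-applyUpTo-+ : ∀ (f g : ℕ → ℕ) {k} → (∀ i → k i ≡ f i + g i) → ∀ n →
                  ∑ (applyUpTo k n) ≡ ∑ (applyUpTo f n) + ∑ (applyUpTo g n)
sum-applyUpTo-+ f g eq zero = refl
sum-applyUpTo-+ f g eq (suc n) =
  trans (cong₂ _+_ (eq 0) (sum-applyUpTo-+ (f ∘ suc) (g ∘ suc) (eq ∘ suc) n))
        (solve 4 (λ a b c d → (a :+ b) :+ (c :+ d) := (a :+ c) :+ (b :+ d)) refl (f 0) (g 0) _ _)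

-- Induction on `j` by Pascal's rule. The parameter `m` must stay general because the recursion
-- raises it.
valleys-sum : ∀ j m → valleys j m ≡ ∑ (applyUpTo (λ k → (j C k) * catalan (suc j + m ∸ k)) (suc j))
valleys-sum zero m =
  trans (ballots-catalan m) (sym (trans (+-identityʳ _) (+-identityʳ _)))
valleys-sum (suc j) m = begin
  valleys j m + valleys j (suc m)
    ≡⟨ cong₂ _+_ (valleys-sum j m) (valleys-sum j (suc m)) ⟩
  ∑ (applyUpTo f (suc j)) + ∑ (applyUpTo g (suc j))
    ≡⟨ cong (∑ (applyUpTo f (suc j)) +_) extend ⟩
  ∑ (applyUpTo f (suc j)) + (g 0 + ∑ (applyUpTo (g ∘ suc) (suc j)))
    ≡⟨ solve 3 (λ a b c → a :+ (b :+ c) := b :+ (a :+ c)) refl (∑ (applyUpTo f (suc j))) (g 0) _ ⟩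
  g 0 + (∑ (applyUpTo f (suc j)) + ∑ (applyUpTo (g ∘ suc) (suc j)))
    ≡⟨ cong₂ _+_ (cong (λ x → 1 * catalan (suc x)) (+-suc j m)) (sym (sum-applyUpTo-+ f (g ∘ suc) split (suc j))) ⟩
  k 0 + ∑ (applyUpTo (k ∘ suc) (suc j)) ∎
  where
  open ≡-Reasoning
  f = λ i → (j C i) * catalan (suc j + m ∸ i)
  g = λ i → (j C i) * catalan (suc j + suc m ∸ i)
  k = λ i → (suc j C i) * catalan (suc (suc j) + m ∸ i)
  -- The added term vanishes because `j C suc j` is 0. Once `g 0` is split off, the two sums have
  -- equally many terms and can be added termwise.
  extend : ∑ (applyUpTo g (suc j)) ≡ ∑ (applyUpTo g (suc (suc j)))
  extend = sym (trans (sum-applyUpTo-∷ʳ g (suc j))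
    (trans (cong (λ x → ∑ (applyUpTo g (suc j)) + x * catalan (suc j + suc m ∸ suc j)) (k>n⇒nCk≡0 (n<1+n j)))
           (+-identityʳ _)))
  split : ∀ i → k (suc i) ≡ f i + g (suc i)
  split i = begin
    (suc j C suc i) * c                              ≡⟨ cong (_* c) (pascal j i) ⟩
    (j C i + j C suc i) * c                          ≡⟨ *-distribʳ-+ c (j C i) (j C suc i) ⟩
    f i + (j C suc i) * c                            ≡⟨ cong (λ x → f i + (j C suc i) * catalan (x ∸ i)) (+-suc j m) ⟨
    f i + g (suc i)                                  ∎
    where c = catalan (suc j + m ∸ i)

-- Inductive encodings of the paths and their enumeration

-- Paths from height h to the diagonal whose north steps carry the labels ls in order.
data Ballot : ℕ → List ℕ → Set where
  done  : Ballot 0 []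
  north : Ballot (suc h) ls → Ballot h (l ∷ ls)
  east  : Ballot h ls → Ballot (suc h) ls

-- The labels 1, …, j + 1 are placed in front of acc, the largest first: on the left it
-- starts a descent, so its north step is followed by an east step back to the diagonal.
data Valley : ℕ → List ℕ → Set where
  bottom : Ballot 0 (1 ∷ acc) → Valley 0 acc
  left   : Valley j acc → Valley (suc j) acc
  right  : Valley j (2 + j ∷ acc) → Valley (suc j) acc

Ballot↔Fin : ∀ h ls → Ballot h ls ↔ Fin (ballots h (length ls))
Ballot↔Fin zero [] = ↔-trans (mk↔ₛ′ (λ _ → tt) (λ _ → done) (λ _ → refl) (λ { done → refl })) (↔-sym 1↔⊤)
Ballot↔Fin zero (l ∷ ls) = ↔-trans
  (mk↔ₛ′ (λ { (north b) → b }) north (λ _ → refl) (λ { (north _) → refl }))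
  (Ballot↔Fin 1 ls)
Ballot↔Fin (suc h) [] = ↔-trans
  (mk↔ₛ′ (λ { (east b) → b }) east (λ _ → refl) (λ { (east _) → refl }))
  (Ballot↔Fin h [])
Ballot↔Fin (suc h) (l ∷ ls) = ↔-trans
  (mk↔ₛ′ (λ { (north b) → inj₁ b ; (east b) → inj₂ b })
         (λ { (inj₁ b) → north b ; (inj₂ b) → east b })
         (λ { (inj₁ _) → refl ; (inj₂ _) → refl })
         (λ { (north _) → refl ; (east _) → refl }))
  (↔-trans (Ballot↔Fin (suc (suc h)) ls ⊎-↔ Ballot↔Fin h (l ∷ ls)) (↔-sym +↔⊎))

Valley↔Fin : ∀ j acc → Valley j acc ↔ Fin (valleys j (length acc))
Valley↔Fin zero acc = ↔-trans
  (mk↔ₛ′ (λ { (bottom b) → b }) bottom (λ _ → refl) (λ { (bottom _) → refl }))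
  (Ballot↔Fin 0 (1 ∷ acc))
Valley↔Fin (suc j) acc = ↔-trans
  (mk↔ₛ′ (λ { (left v) → inj₁ v ; (right v) → inj₂ v })
         (λ { (inj₁ v) → left v ; (inj₂ v) → right v })
         (λ { (inj₁ _) → refl ; (inj₂ _) → refl })
         (λ { (left _) → refl ; (right _) → refl }))
  (↔-trans (Valley↔Fin j acc ⊎-↔ Valley↔Fin j (2 + j ∷ acc)) (↔-sym +↔⊎))

-- Labelled paths of the encodings, and injectivity

path : Ballot h ls → List LabelledStep
path done              = []
path (north {l = l} b) = N l ∷ path b
path (east b)          = E ∷ path b

word : Valley j acc → List LabelledStep
word (bottom b)       = path b
word (left {j = j} v) = N (2 + j) ∷ E ∷ word v
word (right v)        = word v

labels-path : (b : Ballot h ls) → labels (path b) ≡ ls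
labels-path done      = refl
labels-path (north b) = cong (_ ∷_) (labels-path b)
labels-path (east b)  = labels-path b

-- The bound serves twice: it tells `left` from `right`, and it shows that a label placed by `left`
-- starts a descent.
word-head : (v : Valley j acc) → ∃₂ λ l t → word v ≡ N l ∷ t × l ≤ suc j
word-head (bottom (north b)) = 1 , path b , refl , ≤-refl
word-head (left {j = j} v)   = 2 + j , _ , refl , ≤-refl
word-head (right v)          = let l , t , eq , l≤ = word-head v in l , t , eq , m≤n⇒m≤1+n l≤

path-injective : (b b′ : Ballot h ls) → path b ≡ path b′ → b ≡ b′
path-injective done      done       _  = refl
path-injective (north b) (north b′) eq = cong north (path-injective b b′ (∷-injectiveʳ eq))
path-injective (east b)  (east b′)  eq = cong east (path-injective b b′ (∷-injectiveʳ eq))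

left≢right : (v : Valley j acc) (v′ : Valley j (2 + j ∷ acc)) → word (left v) ≢ word (right v′)
left≢right v v′ eq with word-head v′
... | l , t , eq′ , l≤ with ∷-injective (trans eq eq′)
... | refl , _ = 1+n≰n l≤

word-injective : (v v′ : Valley j acc) → word v ≡ word v′ → v ≡ v′
word-injective (bottom b) (bottom b′) eq = cong bottom (path-injective b b′ eq)
word-injective (left v)   (left v′)   eq = cong left (word-injective v v′ (∷-injectiveʳ (∷-injectiveʳ eq)))
word-injective (right v)  (right v′)  eq = cong right (word-injective v v′ eq)
word-injective (left v)   (right v′)  eq = ⊥-elim (left≢right v v′ eq)
word-injective (right v)  (left v′)   eq = ⊥-elim (left≢right v′ v (sym eq))

-- The encoded words satisfy the parking function conditions

-- A starting height `h` lets induction strip the first step; at `h = 0` this is `neverBelowY=X` by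
-- computation.
NeverBelow : ℕ → List Step → Set
NeverBelow h p = ∀ k → easts (take k p) ≤ h + norths (take k p)

neverBelow-N⁺ : ∀ {p} → NeverBelow (suc h) p → NeverBelow h (N ∷ p)
neverBelow-N⁺         nb zero    = z≤n
neverBelow-N⁺ {h} {p} nb (suc k) = subst (easts (take k p) ≤_) (sym (+-suc h _)) (nb k)

neverBelow-N⁻ : ∀ {p} → NeverBelow h (N ∷ p) → NeverBelow (suc h) p
neverBelow-N⁻ {h} {p} nb k = subst (easts (take k p) ≤_) (+-suc h _) (nb (suc k))

neverBelow-E⁺ : ∀ {p} → NeverBelow h p → NeverBelow (suc h) (E ∷ p)
neverBelow-E⁺ nb zero    = z≤n
neverBelow-E⁺ nb (suc k) = s≤s (nb k)

neverBelow-E⁻ : ∀ {p} → NeverBelow (suc h) (E ∷ p) → NeverBelow h p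
neverBelow-E⁻ nb k = s≤s⁻¹ (nb (suc k))

¬neverBelow-E : ∀ {p} → ¬ NeverBelow 0 (E ∷ p)
¬neverBelow-E nb = 1+n≰n (nb 1)

shape : List LabelledStep → List Step
shape = map forgetLabel

norths-shape : ∀ t → norths (shape t) ≡ length (labels t)
norths-shape []        = refl
norths-shape (N _ ∷ t) = cong suc (norths-shape t)
norths-shape (E ∷ t)   = norths-shape t

path-neverBelow : (b : Ballot h ls) → NeverBelow h (shape (path b))
path-neverBelow done      zero    = z≤n
path-neverBelow done      (suc k) = z≤n
path-neverBelow (north b) = neverBelow-N⁺ (path-neverBelow b)
path-neverBelow (east b)  = neverBelow-E⁺ (path-neverBelow b)

word-neverBelow : (v : Valley j acc) → NeverBelow 0 (shape (word v))
word-neverBelow (bottom b) = path-neverBelow b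
word-neverBelow (left v)   = neverBelow-N⁺ (neverBelow-E⁺ (word-neverBelow v))
word-neverBelow (right v)  = word-neverBelow v

path-easts : (b : Ballot h ls) → easts (shape (path b)) ≡ h + norths (shape (path b))
path-easts done              = refl
path-easts (north {h = h} b) = trans (path-easts b) (sym (+-suc h _))
path-easts (east b)          = cong suc (path-easts b)

word-easts : (v : Valley j acc) → easts (shape (word v)) ≡ norths (shape (word v))
word-easts (bottom b) = path-easts b
word-easts (left v)   = cong suc (word-easts v)
word-easts (right v)  = word-easts v

applyUpTo-∷ʳ-++ : ∀ {A : Set} (f : ℕ → A) n xs → applyUpTo f (suc n) ++ xs ≡ applyUpTo f n ++ f n ∷ xs
applyUpTo-∷ʳ-++ f n xs =
  trans (cong (_++ xs) (sym (applyUpTo-∷ʳ f n))) (++-assoc (applyUpTo f n) [ f n ] xs)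

labels-word : (v : Valley j acc) → labels (word v) ↭ applyUpTo suc (suc j) ++ acc
labels-word (bottom b) = ↭-reflexive (labels-path b)
labels-word {acc = acc} (left {j = j} v) = ↭-trans (↭-prep (2 + j) (labels-word v))
  (↭-trans (↭-sym (shift (2 + j) (applyUpTo suc (suc j)) acc))
           (↭-reflexive (sym (applyUpTo-∷ʳ-++ suc (suc j) acc))))
labels-word {acc = acc} (right {j = j} v) = ↭-trans (labels-word v)
  (↭-reflexive (sym (applyUpTo-∷ʳ-++ suc (suc j) acc)))

linked-lower : ∀ {a b} → a < b → Linked _<_ (b ∷ ls) → Linked _<_ (a ∷ ls)
linked-lower _   [-]         = [-]
linked-lower a<b (b<c ∷ lkd) = <-trans a<b b<c ∷ lkd

rising-E : ∀ {t} → Linked RisingIfNorths t → Linked RisingIfNorths (E ∷ t)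
rising-E {[]}    _ = [-]
rising-E {_ ∷ _} r = tt ∷ r

path-rising : Linked _<_ ls → (b : Ballot h ls) → Linked RisingIfNorths (path b)
path-rising _            done                = []
path-rising (l<l′ ∷ lkd) (north b@(north _)) = l<l′ ∷ path-rising lkd b
path-rising lkd          (north b@(east _))  = tt ∷ path-rising (Linked.tail lkd) b
path-rising lkd          (east b)            = rising-E (path-rising lkd b)

-- Invariant: `acc` increases and lies above `suc j`. A step `right` prepends the next smaller label
-- to it, and the east step after a left label removes any condition at that descent.
word-rising : Linked _<_ (suc j ∷ acc) → (v : Valley j acc) → Linked RisingIfNorths (word v)
word-rising lkd (bottom b) = path-rising lkd b
word-rising lkd (left v)   = tt ∷ rising-E (word-rising (linked-lower (n<1+n _) lkd) v)
word-rising lkd (right v)  = word-rising (n<1+n _ ∷ lkd) v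

-- Peaks and pattern avoidance

-- The entries `x` and `z` are not compared, so for distinct entries this combines avoidance of 132
-- and of 231.
Peakless : List ℕ → Set
Peakless u = ∀ {x y z} → x ∷ y ∷ z ∷ [] ⊆ u → x < y → z < y → ⊥

peakless-⊆ : ∀ {u w} → u ⊆ w → Peakless w → Peakless u
peakless-⊆ u⊆w pl p = pl (⊆-trans p u⊆w)

allPairs-⊆ : ∀ {R : ℕ → ℕ → Set} {u w} → u ⊆ w → AllPairs R w → AllPairs R u
allPairs-⊆ []         []         = []
allPairs-⊆ (_ ∷ʳ p)   (_ ∷ rs)   = allPairs-⊆ p rs
allPairs-⊆ (refl ∷ p) (r ∷ rs)   = All-resp-⊆ p r ∷ allPairs-⊆ p rs

linked⇒peakless : ∀ {u} → Linked _<_ u → Peakless u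
linked⇒peakless lkd p _ z<y with allPairs-⊆ p (Linked⇒AllPairs <-trans lkd)
... | _ ∷ (y<z ∷ []) ∷ _ = <-asym y<z z<y

-- A peak x < y > z using the new first entry x = a gives the peak b < y > z.
peakless-∷ : ∀ {a b u} → b < a → Peakless (b ∷ u) → Peakless (a ∷ b ∷ u)
peakless-∷ b<a pl (_ ∷ʳ p)             x<y z<y = pl p x<y z<y
peakless-∷ b<a pl (refl ∷ (_ ∷ʳ p))    x<y z<y = pl (refl ∷ p) (<-trans b<a x<y) z<y
peakless-∷ b<a pl (refl ∷ (refl ∷ p))  x<y z<y = <-asym b<a x<y

-- At `bottom` the labels increase. Each `left` then prepends a label larger than the current first
-- one, which creates no peak.
word-peakless : Linked _<_ (suc j ∷ acc) → (v : Valley j acc) → Peakless (labels (word v))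
word-peakless lkd (bottom b) = subst Peakless (sym (labels-path b)) (linked⇒peakless lkd)
word-peakless lkd (right v)  = word-peakless (n<1+n _ ∷ lkd) v
word-peakless lkd (left v) with word v | word-head v | word-peakless (linked-lower (n<1+n _) lkd) v
... | _ | l , t , refl , l≤ | pl = peakless-∷ (s≤s l≤) pl

-- Turns a sublist into the index map that `Contains` asks for; `triple-⊆` goes the other way.
position : ∀ {u w : List ℕ} → u ⊆ w → Fin (length u) → Fin (length w)
position (_ ∷ʳ p)   i       = suc (position p i)
position (refl ∷ p) zero    = zero
position (refl ∷ p) (suc i) = suc (position p i)

position-mono : ∀ {u w : List ℕ} (p : u ⊆ w) a b → a Fin.< b → position p a Fin.< position p b
position-mono (_ ∷ʳ p)   a       b       a<b       = s<s (position-mono p a b a<b)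
position-mono (refl ∷ p) zero    (suc b) _         = z<s
position-mono (refl ∷ p) (suc a) (suc b) (s≤s a<b) = s<s (position-mono p a b a<b)

lookup-position : ∀ {u w : List ℕ} (p : u ⊆ w) a → lookup w (position p a) ≡ lookup u a
lookup-position (_ ∷ʳ p)   a       = lookup-position p a
lookup-position (refl ∷ p) zero    = refl
lookup-position (refl ∷ p) (suc a) = lookup-position p a

singleton-⊆ : ∀ (w : List ℕ) i → [ lookup w i ] ⊆ w
singleton-⊆ (x ∷ w) zero    = refl ∷ minimum w
singleton-⊆ (x ∷ w) (suc i) = x ∷ʳ singleton-⊆ w i

pair-⊆ : ∀ (w : List ℕ) {i k} → i Fin.< k → lookup w i ∷ lookup w k ∷ [] ⊆ w
pair-⊆ (x ∷ w) {zero}  {suc k} _         = refl ∷ singleton-⊆ w k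
pair-⊆ (x ∷ w) {suc i} {suc k} (s≤s i<k) = x ∷ʳ pair-⊆ w i<k

triple-⊆ : ∀ (w : List ℕ) {i k m} → i Fin.< k → k Fin.< m → lookup w i ∷ lookup w k ∷ lookup w m ∷ [] ⊆ w
triple-⊆ (x ∷ w) {zero}  {suc k} {suc m} _         (s≤s k<m) = refl ∷ pair-⊆ w k<m
triple-⊆ (x ∷ w) {suc i} {suc k} {suc m} (s≤s i<k) (s≤s k<m) = x ∷ʳ triple-⊆ w i<k k<m

-- A strict comparison settles the equivalence in `Contains` for a pair of indices in either order,
-- so three of these cover all pairs of distinct indices.
data SameOrder (x y x′ y′ : ℕ) : Set where
  both< : x < y → x′ < y′ → SameOrder x y x′ y′
  both> : y < x → y′ < x′ → SameOrder x y x′ y′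

sameOrder⇒⇔ : ∀ {x y x′ y′} → SameOrder x y x′ y′ → (x ≤ y) ⇔ (x′ ≤ y′)
sameOrder⇒⇔ (both< x<y x′<y′) = mk⇔ (λ _ → <⇒≤ x′<y′) (λ _ → <⇒≤ x<y)
sameOrder⇒⇔ (both> y<x y′<x′) = mk⇔ (contradiction y<x ∘ ≤⇒≯) (contradiction y′<x′ ∘ ≤⇒≯)

sameOrder-flip : ∀ {x y x′ y′} → SameOrder x y x′ y′ → SameOrder y x y′ x′
sameOrder-flip (both< p q) = both> p q
sameOrder-flip (both> p q) = both< p q

triple-sameOrder : ∀ {x y z x′ y′ z′} → SameOrder x y x′ y′ → SameOrder x z x′ z′ → SameOrder y z y′ z′ →
                   ∀ a b → (lookup (x ∷ y ∷ z ∷ []) a ≤ lookup (x ∷ y ∷ z ∷ []) b)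
                         ⇔ (lookup (x′ ∷ y′ ∷ z′ ∷ []) a ≤ lookup (x′ ∷ y′ ∷ z′ ∷ []) b)
triple-sameOrder xy xz yz = λ where
    zero             zero             → mk⇔ (λ _ → ≤-refl) (λ _ → ≤-refl)
    zero             (suc zero)       → sameOrder⇒⇔ xy
    zero             (suc (suc zero)) → sameOrder⇒⇔ xz
    (suc zero)       zero             → sameOrder⇒⇔ (sameOrder-flip xy)
    (suc zero)       (suc zero)       → mk⇔ (λ _ → ≤-refl) (λ _ → ≤-refl)
    (suc zero)       (suc (suc zero)) → sameOrder⇒⇔ yz
    (suc (suc zero)) zero             → sameOrder⇒⇔ (sameOrder-flip xz)
    (suc (suc zero)) (suc zero)       → sameOrder⇒⇔ (sameOrder-flip yz)
    (suc (suc zero)) (suc (suc zero)) → mk⇔ (λ _ → ≤-refl) (λ _ → ≤-refl)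

contains : ∀ {n m} (π : Perm n) {x y z x′ y′ z′} (σ : x′ ∷ y′ ∷ z′ ∷ [] ↭ applyUpTo suc m) →
           x ∷ y ∷ z ∷ [] ⊆ oneLine π →
           SameOrder x y x′ y′ → SameOrder x z x′ z′ → SameOrder y z y′ z′ →
           Contains π (perm _ σ)
contains π {x} {y} {z} {x′} {y′} {z′} σ p xy xz yz = position p , position-mono p , iso
  where
  iso : ∀ a b → (lookup (oneLine π) (position p a) ≤ lookup (oneLine π) (position p b))
              ⇔ (lookup (x′ ∷ y′ ∷ z′ ∷ []) a ≤ lookup (x′ ∷ y′ ∷ z′ ∷ []) b)
  iso a b rewrite lookup-position p a | lookup-position p b = triple-sameOrder xy xz yz a b

-- A peak with `x < z` is an occurrence of 132, one with `z < x` an occurrence of 231, and `x ≡ z`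
-- contradicts distinctness.
avoids⇒peakless : ∀ {n} (π : Perm n) → Unique (oneLine π) →
                  Avoids π p132 → Avoids π p231 → Peakless (oneLine π)
avoids⇒peakless π unique ¬132 ¬231 {x} {y} {z} p x<y z<y with <-cmp x z
... | tri< x<z _ _ = ¬132 (contains π (isPermutation p132) p
  (both< x<y (s<s z<s)) (both< x<z (s<s z<s)) (both> z<y (s<s (s<s z<s))))
... | tri> _ _ z<x = ¬231 (contains π (isPermutation p231) p
  (both< x<y (s<s (s<s z<s))) (both> z<x (s<s z<s)) (both> z<y (s<s z<s)))
... | tri≈ _ x≡z _ with allPairs-⊆ p unique
...   | (_ ∷ x≢z ∷ []) ∷ _ = x≢z x≡z

-- Handles both patterns at once: an occurrence of any pattern whose middle entry is the largest is
-- a peak.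
peakless⇒avoids : ∀ {n m} (π : Perm n) {x y z} (σ : x ∷ y ∷ z ∷ [] ↭ applyUpTo suc m) →
                  x < y → z < y → Peakless (oneLine π) → Avoids π (perm _ σ)
peakless⇒avoids π σ x<y z<y pl (i , mono , iso) =
  pl (triple-⊆ (oneLine π) (mono zero (suc zero) z<s) (mono (suc zero) (suc (suc zero)) (s<s z<s)))
     (≰⇒> (<⇒≱ x<y ∘ Equivalence.to (iso (suc zero) zero)))
     (≰⇒> (<⇒≱ z<y ∘ Equivalence.to (iso (suc zero) (suc (suc zero)))))

-- Surjectivity of the encodings

-- Reads `t` step by step. An east step at height 0 would cross the diagonal, and ending at positive
-- height would contradict the count of east steps.
path-surjective : ∀ h {ls} t → labels t ≡ ls → NeverBelow h (shape t) →
                  easts (shape t) ≡ h + norths (shape t) → ∃ λ (b : Ballot h ls) → path b ≡ t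
path-surjective zero    []        refl nb es = done , refl
path-surjective h       (N l ∷ t) refl nb es
  with b , eq ← path-surjective (suc h) t refl (neverBelow-N⁻ nb) (trans es (+-suc h _))
  = north b , cong (N l ∷_) eq
path-surjective zero    (E ∷ t)   refl nb es = ⊥-elim (¬neverBelow-E nb)
path-surjective (suc h) (E ∷ t)   refl nb es
  with b , eq ← path-surjective h t refl (neverBelow-E⁻ nb) (suc-injective es)
  = east b , cong (E ∷_) eq

↭-bounded : ∀ {n us} → us ↭ applyUpTo suc n → All (_≤ n) us
↭-bounded {n} us↭ = All-resp-↭ (↭-sym us↭) (All-applyUpTo⁺ suc n (λ i<n → i<n))

-- The label a exceeds the next one, so a second north step cannot follow.
descent : ∀ t {a us} → us ↭ applyUpTo suc (suc j) → labels t ≡ a ∷ us ++ acc → suc j < a →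
          NeverBelow 0 (shape t) → Linked RisingIfNorths t →
          ∃ λ t′ → t ≡ N a ∷ E ∷ t′ × labels t′ ≡ us ++ acc
descent (E ∷ t) us↭ eq j<a nb rising = ⊥-elim (¬neverBelow-E nb)
descent (N a ∷ E ∷ t) us↭ eq j<a nb rising with refl , eq′ ← ∷-injective eq = t , refl , eq′
-- Since `us` has `suc j` entries, the label after `a` comes from `us` and not from `acc`, so it is
-- at most `suc j`.
descent (N a ∷ []) {us = []} us↭ eq j<a nb rising with () ← ↭-length us↭
descent {j = j} (N a ∷ N b ∷ t) {us = []} us↭ eq j<a nb rising with () ← ↭-length us↭
descent {j = j} (N a ∷ N b ∷ t) {us = u ∷ us} us↭ eq j<a nb (a<b ∷ _)
  with refl , eq′ ← ∷-injective eq
  with refl , _ ← ∷-injective eq′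
  with b≤j ∷ _ ← ↭-bounded us↭ =
  ⊥-elim (<⇒≱ (<-trans j<a a<b) b≤j)

-- In a peakless word the largest label occupies the first or the last position.
word-surjective : ∀ j {acc} t u → labels t ≡ u ++ acc → u ↭ applyUpTo suc (suc j) → Peakless u →
                  NeverBelow 0 (shape t) → easts (shape t) ≡ norths (shape t) →
                  Linked RisingIfNorths t → ∃ λ (v : Valley j acc) → word v ≡ t
word-surjective zero t u eq u↭ pl nb es rising
  with refl ← ↭-singleton-inv u↭
  with b , eq′ ← path-surjective 0 t eq nb es
  = bottom b , eq′
word-surjective (suc j) {acc} t u eq u↭ pl nb es rising
  with ∈-∃++ (∈-resp-↭ (↭-sym u↭) (∈-applyUpTo⁺ suc (n<1+n (suc j))))
... | xs , zs , refl = split xs zs eq pl rest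
  where
  rest : xs ++ zs ↭ applyUpTo suc (suc j)
  rest = ↭-trans
    (drop-mid xs (applyUpTo suc (suc j)) (↭-trans u↭ (↭-reflexive (sym (applyUpTo-∷ʳ suc (suc j))))))
    (↭-reflexive (++-identityʳ _))

  split : ∀ xs zs → labels t ≡ (xs ++ 2 + j ∷ zs) ++ acc → Peakless (xs ++ 2 + j ∷ zs) →
          xs ++ zs ↭ applyUpTo suc (suc j) → ∃ λ (v : Valley (suc j) acc) → word v ≡ t
  -- The largest label comes first: strip its north step and the forced east step.
  split [] zs eq pl rest with descent t rest eq (n<1+n (suc j)) nb rising
  ... | t′ , refl , eq′
    with v , refl ← word-surjective j t′ zs eq′ rest (peakless-⊆ (_ ∷ʳ ⊆-refl) pl)
                      (neverBelow-E⁻ (neverBelow-N⁻ nb)) (suc-injective es)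
                      (Linked.tail (Linked.tail rising))
    = left v , refl
  -- The largest label comes last: the path stays the same and the label passes to `acc`.
  split xs@(_ ∷ _) [] eq pl rest
    with v , refl ← word-surjective j t xs (trans eq (++-assoc xs [ 2 + j ] acc))
                      (↭-trans (↭-reflexive (sym (++-identityʳ xs))) rest)
                      (peakless-⊆ (Sublist.++⁺ʳ [ 2 + j ] ⊆-refl) pl) nb es rising
    = right v , refl
  -- With labels on both sides, `x`, `2 + j` and `z` form a peak.
  split (x ∷ xs) (z ∷ zs) eq pl rest
    with x≤ ∷ others ← ↭-bounded rest
    with z≤ ∷ _ ← proj₂ (All-++⁻ xs others)
    = ⊥-elim (pl (refl ∷ Sublist.++⁺ˡ xs (refl ∷ refl ∷ minimum zs)) (s≤s x≤) (s≤s z≤))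

-- The bijection with avoiding parking functions and the count

unique-applyUpTo-suc : ∀ n → Unique (applyUpTo suc n)
unique-applyUpTo-suc n = applyUpTo⁺₁ suc n (λ i<j _ → <⇒≢ (s<s i<j))

unique-↭ : ∀ {u w : List ℕ} → u ↭ w → Unique u → Unique w
unique-↭ u↭w = Permutationₛ.Unique-resp-↭ (setoid ℕ) (↭⇒↭ₛ u↭w)

avoiding : ℕ → Setoid 0ℓ 0ℓ
avoiding n = avoidingParkingFunctions n ((3 , p132) ∷ (3 , p231) ∷ [])

parking : Valley j [] → Setoid.Carrier (avoiding (suc j))
parking {j = j} v = p , peakless⇒avoids (φ p) (isPermutation p132) (s<s z<s) (s<s (s<s z<s)) peakless
                      ∷ peakless⇒avoids (φ p) (isPermutation p231) (s<s (s<s z<s)) (s<s z<s) peakless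
                      ∷ []
  where
  labels↭ : labels (word v) ↭ applyUpTo suc (suc j)
  labels↭ = ↭-trans (labels-word v) (↭-reflexive (++-identityʳ _))
  norths≡ : norths (shape (word v)) ≡ suc j
  norths≡ = trans (norths-shape (word v)) (trans (↭-length labels↭) (length-applyUpTo suc (suc j)))
  p : ParkingFunction (suc j)
  p = record
    { steps     = word v
    ; isDyck    = record
        { norths≡n      = norths≡
        ; easts≡n       = trans (word-easts v) norths≡
        ; neverBelowY=X = word-neverBelow v
        }
    ; bijective = labels↭
    ; rising    = word-rising [-] v
    }
  peakless : Peakless (labels (word v))
  peakless = word-peakless [-] v

parking-surjective : (p : Setoid.Carrier (avoiding (suc j))) → ∃ λ (v : Valley j []) → word v ≡ steps (proj₁ p)
parking-surjective {j} (p , ¬132 ∷ ¬231 ∷ []) =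
  word-surjective j (steps p) (labels (steps p)) (sym (++-identityʳ _)) (bijective p)
    (avoids⇒peakless (φ p) (unique-↭ (↭-sym (bijective p)) (unique-applyUpTo-suc (suc j))) ¬132 ¬231)
    (neverBelowY=X (isDyck p)) (trans (easts≡n (isDyck p)) (sym (norths≡n (isDyck p)))) (rising p)
  where open IsDyckPath

-- The setoid compares steps only, so injectivity of `word` and its surjectivity onto the step lists
-- of avoiding parking functions suffice.
avoiding↔Valley : ∀ j → Inverse (avoiding (suc j)) (setoid (Valley j []))
avoiding↔Valley j = Symmetry.inverse (Bijection⇒Inverse (record
  { to        = parking
  ; cong      = cong word
  ; bijective = (λ {v} {v′} → word-injective v v′)
              , λ p → let v , eq = parking-surjective p in v , λ { refl → eq }
  }))

theorem22 : (n : ℕ) → n ≥ 1 →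
    HasCardinality (avoidingParkingFunctions n ((3 , p132) ∷ (3 , p231) ∷ []))
    (sum (map (λ k → ((n ∸ 1) C k) * catalan (n ∸ k)) (upTo n)))
theorem22 (suc j) _ = subst (HasCardinality (avoiding (suc j))) count
  (Composition.inverse (avoiding↔Valley j) (Valley↔Fin j []))
  where
  count : valleys j 0 ≡ sum (map (λ k → (j C k) * catalan (suc j ∸ k)) (upTo (suc j)))
  count = trans (valleys-sum j 0)
    (trans (cong (λ i → ∑ (applyUpTo (λ k → (j C k) * catalan (suc i ∸ k)) (suc j))) (+-identityʳ j))
           (cong ∑ (sym (map-upTo (λ k → (j C k) * catalan (suc j ∸ k)) (suc j)))))
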